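{- Let $m,n\in\mathbb{N}$ with $m\geq 3$ odd, and let $x=(q,\epsilon_1,\ldots,\epsilon_{n-1})$ and $x'=(q',\epsilon'_1,\ldots,\epsilon'_{n-1})$ be elements of $\mathbb{Z}_m\times\{\pm1\}^{n-1}$. If $\iota_n(x)\cap\iota_n(x')=\emptyset$, then $q'\equiv q\pm 1\pmod m$ and $\epsilon_j=\epsilon'_j$ for all $j\in[n-1]$.
   Context: The discrete torus $\mathbb{Z}_m^n$ has vertex set $\{0,1,\ldots,m-1\}^n$. For $(q,\epsilon_1,\ldots,\epsilon_{n-1})\in \mathbb{Z}_m\times\{\pm1\}^{n-1}$, \[ \iota_n(q,\epsilon_1,\ldots,\epsilon_{n-1}) := \Big\{ v\in \{0,\ldots,m-1\}^n : v_1 + \sum_{i=1}^{n-1}\epsilon_i v_{i+1} \in \{q, q+2, \ldots, q+m-3\} \pmod m\Big\}. \] -}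

module Defs where

open import Data.Nat as ℕ using (ℕ; zero; suc; _∸_; _<_)
open import Data.Nat.DivMod using (_/_)
open import Data.Integer as ℤ using (ℤ; +_; _+_; _-_; _*_)
open import Data.Integer.Divisibility using (_∣_)
open import Data.Fin using (Fin; toℕ)
open import Data.Vec using (Vec; []; _∷_)
open import Data.Sign using (Sign)
open import Data.Product using (Σ; _×_)

-- ±1 as an integer
signℤ : Sign → ℤ
signℤ Sign.+ = + 1
signℤ Sign.- = ℤ.-[1+ 0 ]

-- Σ_i ε_i · w_i  (as an integer, with w_i ∈ {0,…,m-1})
signedSum : ∀ {m k} → Vec Sign k → Vec (Fin m) k → ℤ
signedSum [] [] = + 0
signedSum (e ∷ es) (w ∷ ws) = signℤ e * (+ toℕ w) + signedSum es ws

-- the linear form  v₁ + Σ_{i=1}^{n-1} ε_i v_{i+1},  with n = suc k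
linForm : ∀ {m k} → Vec Sign k → Vec (Fin m) (suc k) → ℤ
linForm es (v₁ ∷ vs) = + toℕ v₁ + signedSum es vs

-- congruence modulo m on integers
infix 4 _≡[mod_]_
_≡[mod_]_ : ℤ → ℕ → ℤ → Set
a ≡[mod m ] b = (+ m) ∣ (a - b)

-- ι_n(q, ε) as a predicate on vertices v ∈ {0,…,m-1}^n (n = suc k):
-- the linear form lies in {q, q+2, …, q+m-3} mod m, i.e. ≡ q + 2j for some
-- j with 0 ≤ j ≤ (m-3)/2, equivalently j < (m-1)/2.
ι : ∀ {m k} → Fin m → Vec Sign k → Vec (Fin m) (suc k) → Set
ι {m} q es v = Σ ℕ λ j → (j < (m ∸ 1) / 2) × (linForm es v ≡[mod m ] (+ toℕ q + + (2 ℕ.* j)))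

-- Write m = 2h + 1, so that ι(q, ε) is the set of vertices whose linear form lies in
-- q + {0, 2, …, 2h − 2}. If ε ≠ ε', then at a coordinate where the signs differ the two
-- linear forms differ by ±2 times that coordinate; as 2 is invertible modulo m, a vertex
-- can be chosen on which the forms take the values q and q', so ι(x) and ι(x') meet.
-- If ε = ε', the two sets meet as soon as q' − q ≡ 2j − 2j' with j, j' < h, and these
-- differences cover every residue modulo 2h + 1 except ±1.
module Submission where

open import Defs
open import Data.Nat using (ℕ; suc; _≤_; _%_)
open import Data.Integer using (+_; _+_; _-_)
open import Data.Fin using (Fin; toℕ)
open import Data.Vec using (Vec)
open import Data.Sign using (Sign)
open import Data.Product using (_×_)
open import Data.Sum using (_⊎_)
open import Relation.Nullary using (¬_)
open import Relation.Binary.PropositionalEquality using (_≡_)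

open import Data.Nat as ℕ using (zero; _∸_; _<_; z≤n; s≤s; s≤s⁻¹; NonZero)
import Data.Nat.Properties as ℕₚ
open import Data.Nat.DivMod using (_/_; m*n/n≡m; m≡m%n+[m/n]*n; m≥n⇒m/n>0)
import Data.Nat.Tactic.RingSolver as ℕ-Solver
open import Data.Integer using (ℤ; -_; _*_)
import Data.Integer.Properties as ℤₚ
open import Data.Integer.DivMod using (_%ℕ_; _/ℕ_; n%ℕd<d; a≡a%ℕn+[a/ℕn]*n)
import Data.Integer.Divisibility.Signed as Signed
open import Data.Integer.Tactic.RingSolver using (solve-∀)
open import Data.Fin using (zero; fromℕ<)
open import Data.Fin.Properties using (toℕ-fromℕ<; toℕ<n)
open import Data.Vec using ([]; _∷_; replicate)
import Data.Vec.Properties as Vecₚ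
import Data.Sign.Properties as Signₚ
open import Data.Product using (Σ; _,_)
open import Data.Sum using (inj₁; inj₂)
open import Data.Empty using (⊥-elim)
open import Function using (_∘_)
open import Level using (0ℓ)
open import Relation.Binary.Bundles using (Setoid)
import Relation.Binary.Reasoning.Setoid
open import Relation.Nullary using (yes; no)
open import Relation.Binary.PropositionalEquality using (_≢_; refl; sym; trans; cong; cong₂; subst; module ≡-Reasoning)

-- `a ≡[mod m ] b` unfolds to a divisibility of ∣ a - b ∣, from which Agda cannot
-- recover a and b; this wrapper keeps them inferable.
infix 4 _≈_[mod_]
record _≈_[mod_] (a b : ℤ) (m : ℕ) : Set where
  constructor wrap
  field unwrap : a ≡[mod m ] b
open _≈_[mod_]

module _ {m : ℕ} where

  private
    fromSigned : ∀ {x} a b → x ≡ a - b → + m Signed.∣ x → a ≈ b [mod m ]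
    fromSigned _ _ refl m∣x = wrap (Signed.∣⇒∣ᵤ m∣x)

    toSigned : ∀ {a b} → a ≈ b [mod m ] → + m Signed.∣ a - b
    toSigned (wrap a≡b) = Signed.∣ᵤ⇒∣ a≡b

  multiple⇒≈ : ∀ {a b} c → a - b ≡ c * + m → a ≈ b [mod m ]
  multiple⇒≈ {a} {b} c eq = fromSigned a b refl (Signed.divides c eq)

  ≈-refl : ∀ {a} → a ≈ a [mod m ]
  ≈-refl {a} = multiple⇒≈ (+ 0) (ℤₚ.+-inverseʳ a)

  ≡⇒≈ : ∀ {a b} → a ≡ b → a ≈ b [mod m ]
  ≡⇒≈ refl = ≈-refl

  ≈-sym : ∀ {a b} → a ≈ b [mod m ] → b ≈ a [mod m ]
  ≈-sym {a} {b} a≈b = fromSigned b a (neg-minus a b) (Signed.∣m⇒∣-m (toSigned a≈b))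
    where
    neg-minus : ∀ a b → - (a - b) ≡ b - a
    neg-minus = solve-∀

  ≈-trans : ∀ {a b c} → a ≈ b [mod m ] → b ≈ c [mod m ] → a ≈ c [mod m ]
  ≈-trans {a} {b} {c} a≈b b≈c =
    fromSigned a c (ℤₚ.+-minus-telescope a b c) (Signed.∣m∣n⇒∣m+n (toSigned a≈b) (toSigned b≈c))

  +-congˡ-≈ : ∀ a {b c} → b ≈ c [mod m ] → a + b ≈ a + c [mod m ]
  +-congˡ-≈ a {b} {c} b≈c = fromSigned (a + b) (a + c) (shift a b c) (toSigned b≈c)
    where
    shift : ∀ a b c → b - c ≡ (a + b) - (a + c)
    shift = solve-∀

  +-congʳ-≈ : ∀ c {a b} → a ≈ b [mod m ] → a + c ≈ b + c [mod m ]
  +-congʳ-≈ c {a} {b} a≈b = fromSigned (a + c) (b + c) (shift a b c) (toSigned a≈b)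
    where
    shift : ∀ a b c → a - b ≡ (a + c) - (b + c)
    shift = solve-∀

  neg-cong-≈ : ∀ {a b} → a ≈ b [mod m ] → - a ≈ - b [mod m ]
  neg-cong-≈ {a} {b} a≈b = fromSigned (- a) (- b) (minus-neg a b) (Signed.∣m⇒∣-m (toSigned a≈b))
    where
    minus-neg : ∀ a b → - (a - b) ≡ - a - - b
    minus-neg = solve-∀

  *-congˡ-≈ : ∀ c {a b} → a ≈ b [mod m ] → c * a ≈ c * b [mod m ]
  *-congˡ-≈ c {a} {b} a≈b = fromSigned (c * a) (c * b) (times-minus c a b) (Signed.∣n⇒∣m*n c (toSigned a≈b))
    where
    times-minus : ∀ c a b → c * (a - b) ≡ c * a - c * b
    times-minus = solve-∀

  multiple≈0 : ∀ c → c * + m ≈ + 0 [mod m ]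
  multiple≈0 c = multiple⇒≈ c (ℤₚ.+-identityʳ (c * + m))

  modulus≈0 : + m ≈ + 0 [mod m ]
  modulus≈0 = subst (_≈ + 0 [mod m ]) (ℤₚ.*-identityˡ (+ m)) (multiple≈0 (+ 1))

≈-setoid : ℕ → Setoid 0ℓ 0ℓ
≈-setoid m = record
  { Carrier = ℤ
  ; _≈_ = _≈_[mod m ]
  ; isEquivalence = record { refl = ≈-refl ; sym = ≈-sym ; trans = ≈-trans }
  }

module ≈-Reasoning (m : ℕ) = Relation.Binary.Reasoning.Setoid (≈-setoid m)

minus≈⇒≈+ : ∀ {m} a b c → b - a ≈ c [mod m ] → b ≈ a + c [mod m ]
minus≈⇒≈+ {m} a b c b-a≈c = begin
  b            ≡⟨ regroup a b ⟩
  a + (b - a)  ≈⟨ +-congˡ-≈ a b-a≈c ⟩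
  a + c        ∎
  where
  open ≈-Reasoning m
  regroup : ∀ a b → b ≡ a + (b - a)
  regroup = solve-∀

≈⇒minus≈0 : ∀ {m} a b → a ≈ b [mod m ] → a - b ≈ + 0 [mod m ]
≈⇒minus≈0 {m} a b a≈b = begin
  a - b  ≈⟨ +-congʳ-≈ (- b) a≈b ⟩
  b - b  ≡⟨ ℤₚ.+-inverseʳ b ⟩
  + 0    ∎
  where open ≈-Reasoning m

meeting-point : ∀ {m r} t t' s s' → r ≈ t - s [mod m ] → s - s' ≈ t - t' [mod m ] →
  r + s ≈ t [mod m ] × r + s' ≈ t' [mod m ]
meeting-point {m} {r} t t' s s' r≈t-s gap =
  (begin
    r + s        ≈⟨ +-congʳ-≈ s r≈t-s ⟩
    t - s + s    ≡⟨ cancel-s t s ⟩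
    t            ∎) ,
  (begin
    r + s'               ≈⟨ +-congʳ-≈ s' r≈t-s ⟩
    t - s + s'           ≡⟨ regroup t s s' ⟩
    t - (s - s')         ≈⟨ +-congˡ-≈ t (neg-cong-≈ gap) ⟩
    t - (t - t')         ≡⟨ cancel-t t t' ⟩
    t'                   ∎)
  where
  open ≈-Reasoning m
  cancel-s : ∀ t s → t - s + s ≡ t
  cancel-s = solve-∀
  regroup : ∀ t s s' → t - s + s' ≡ t - (s - s')
  regroup = solve-∀
  cancel-t : ∀ t t' → t - (t - t') ≡ t'
  cancel-t = solve-∀

residue : ∀ m .{{_ : NonZero m}} z → Σ (Fin m) λ r → + toℕ r ≈ z [mod m ]
residue m z = fromℕ< (n%ℕd<d z m) , multiple⇒≈ (- (z /ℕ m)) (begin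
  + toℕ (fromℕ< (n%ℕd<d z m)) - z
    ≡⟨ cong₂ _-_ (cong +_ (toℕ-fromℕ< (n%ℕd<d z m))) (a≡a%ℕn+[a/ℕn]*n z m) ⟩
  + (z %ℕ m) - (+ (z %ℕ m) + (z /ℕ m) * + m)
    ≡⟨ cancel (+ (z %ℕ m)) (z /ℕ m) (+ m) ⟩
  - (z /ℕ m) * + m ∎)
  where
  open ≡-Reasoning
  cancel : ∀ r q m → r - (r + q * m) ≡ - q * m
  cancel = solve-∀

data ParityView : ℕ → Set where
  even : ∀ t → ParityView (t ℕ.* 2)
  odd  : ∀ t → ParityView (suc (t ℕ.* 2))

parityView : ∀ n → ParityView n
parityView zero = even 0
parityView (suc n) with parityView n
... | even t = odd t
... | odd t = even (suc t)

EvenDifference : ℕ → ℕ → Set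
EvenDifference h d = Σ ℕ λ j → Σ ℕ λ j' →
  j < h × j' < h × + (2 ℕ.* j) ≈ + d + + (2 ℕ.* j') [mod suc (h ℕ.* 2) ]

evenDifference-even : ∀ {h t} → 0 < h → t < h → EvenDifference h (t ℕ.* 2)
evenDifference-even {t = t} 0<h t<h = t , 0 , t<h , 0<h , ≡⇒≈ (cong +_ (swap t))
  where
  swap : ∀ t → 2 ℕ.* t ≡ t ℕ.* 2 ℕ.+ 0
  swap = ℕ-Solver.solve-∀

evenDifference-wrap : ∀ t u → EvenDifference (suc (suc t ℕ.+ u)) (suc (suc t ℕ.* 2))
evenDifference-wrap t u = 0 , suc u , s≤s z≤n , s≤s (s≤s (ℕₚ.m≤n+m u t)) ,
  ≈-sym (≈-trans (≡⇒≈ (cong +_ (wrap-around t u))) modulus≈0)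
  where
  wrap-around : ∀ t u → suc (suc t ℕ.* 2) ℕ.+ 2 ℕ.* suc u ≡ suc (suc (suc t ℕ.+ u) ℕ.* 2)
  wrap-around = ℕ-Solver.solve-∀

±1⊎evenDifference : ∀ {h d} → 0 < h → d < suc (h ℕ.* 2) → d ≡ 1 ⊎ d ≡ h ℕ.* 2 ⊎ EvenDifference h d
±1⊎evenDifference {h} {d} 0<h d<m with parityView d
... | even t with ℕₚ.m≤n⇒m<n∨m≡n (ℕₚ.*-cancelʳ-≤ t h 2 (s≤s⁻¹ d<m))
...   | inj₁ t<h = inj₂ (inj₂ (evenDifference-even 0<h t<h))
...   | inj₂ refl = inj₂ (inj₁ refl)
±1⊎evenDifference 0<h d<m | odd zero = inj₁ refl
±1⊎evenDifference {h} 0<h d<m | odd (suc t) with ℕₚ.m≤n⇒∃[o]m+o≡n (ℕₚ.*-cancelʳ-< 2 (suc t) h (s≤s⁻¹ d<m))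
... | u , refl = inj₂ (inj₂ (evenDifference-wrap t u))

signedSum-zeros : ∀ {m k} (ε : Vec Sign k) → signedSum ε (replicate k (zero {m})) ≡ + 0
signedSum-zeros [] = refl
signedSum-zeros (e ∷ ε) = cong₂ _+_ (ℤₚ.*-zeroʳ (signℤ e)) (signedSum-zeros ε)

-- 1 + h is the inverse of 2 modulo 2h + 1.
2*-surjective : ∀ h z → Σ (Fin (suc (h ℕ.* 2))) λ r → + 2 * + toℕ r ≈ z [mod suc (h ℕ.* 2) ]
2*-surjective h z with residue (suc (h ℕ.* 2)) (+ suc h * z)
... | r , r≈ = r , (begin
  + 2 * + toℕ r                  ≈⟨ *-congˡ-≈ (+ 2) r≈ ⟩
  + 2 * (+ suc h * z)            ≡⟨ halving (+ h) z ⟩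
  z + z * (+ 1 + + h * + 2)      ≡⟨ cong (λ n → z + z * (+ 1 + n)) (ℤₚ.pos-* h 2) ⟨
  z + z * + suc (h ℕ.* 2)        ≈⟨ +-congˡ-≈ z (multiple≈0 z) ⟩
  z + + 0                        ≡⟨ ℤₚ.+-identityʳ z ⟩
  z                              ∎)
  where
  open ≈-Reasoning (suc (h ℕ.* 2))
  halving : ∀ h z → + 2 * ((+ 1 + h) * z) ≡ z + z * (+ 1 + h * + 2)
  halving = solve-∀

signDifference-surjective : ∀ h {e e' : Sign} → e ≢ e' → ∀ z →
  Σ (Fin (suc (h ℕ.* 2))) λ r → (signℤ e - signℤ e') * + toℕ r ≈ z [mod suc (h ℕ.* 2) ]
signDifference-surjective _ {Sign.+} {Sign.+} +≢+ = ⊥-elim (+≢+ refl)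
signDifference-surjective _ {Sign.-} {Sign.-} -≢- = ⊥-elim (-≢- refl)
signDifference-surjective h {Sign.+} {Sign.-} _ z = 2*-surjective h z
signDifference-surjective h {Sign.-} {Sign.+} _ z =
  let r , 2r≈-z = 2*-surjective h (- z)
  in  r , (begin
    - + 2 * + toℕ r    ≡⟨ ℤₚ.neg-distribˡ-* (+ 2) (+ toℕ r) ⟨
    - (+ 2 * + toℕ r)  ≈⟨ neg-cong-≈ 2r≈-z ⟩
    - - z              ≡⟨ ℤₚ.neg-involutive z ⟩
    z                  ∎)
  where open ≈-Reasoning (suc (h ℕ.* 2))

SignedSumGap : ∀ {k} m → Vec Sign k → Vec Sign k → ℤ → Set
SignedSumGap {k} m ε ε' z = Σ (Vec (Fin m) k) λ vs → signedSum ε vs - signedSum ε' vs ≈ z [mod m ]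

SignedSumGap-∷ : ∀ {m k} e {ε ε' : Vec Sign k} {z} →
  SignedSumGap (suc m) ε ε' z → SignedSumGap (suc m) (e ∷ ε) (e ∷ ε') z
SignedSumGap-∷ e (vs , gap) = zero ∷ vs , ≈-trans (≡⇒≈ (same-head (signℤ e) _ _)) gap
  where
  same-head : ∀ a s s' → (a * + 0 + s) - (a * + 0 + s') ≡ s - s'
  same-head = solve-∀

SignedSumGap-opposite : ∀ h {k} {e e'} (ε ε' : Vec Sign k) → e ≢ e' → ∀ z →
  SignedSumGap (suc (h ℕ.* 2)) (e ∷ ε) (e' ∷ ε') z
SignedSumGap-opposite h {k} {e} {e'} ε ε' e≢e' z =
  let r , gap = signDifference-surjective h e≢e' z in
  r ∷ zeros , ≈-trans (≡⇒≈ (tail-vanishes (+ toℕ r))) gap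
  where
  open ≡-Reasoning
  zeros : Vec (Fin (suc (h ℕ.* 2))) k
  zeros = replicate k zero
  tail-vanishes : ∀ x → (signℤ e * x + signedSum ε zeros) - (signℤ e' * x + signedSum ε' zeros)
                        ≡ (signℤ e - signℤ e') * x
  tail-vanishes x = begin
    (signℤ e * x + signedSum ε zeros) - (signℤ e' * x + signedSum ε' zeros)
      ≡⟨ cong₂ (λ s s' → (signℤ e * x + s) - (signℤ e' * x + s')) (signedSum-zeros ε) (signedSum-zeros ε') ⟩
    (signℤ e * x + + 0) - (signℤ e' * x + + 0)
      ≡⟨ opposite-heads (signℤ e) (signℤ e') x ⟩
    (signℤ e - signℤ e') * x ∎
    where
    opposite-heads : ∀ a a' x → (a * x + + 0) - (a' * x + + 0) ≡ (a - a') * x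
    opposite-heads = solve-∀

signedSum-separates : ∀ h {k} {ε ε' : Vec Sign k} → ε ≢ ε' → ∀ z → SignedSumGap (suc (h ℕ.* 2)) ε ε' z
signedSum-separates _ {ε = []} {[]} []≢[] = ⊥-elim ([]≢[] refl)
signedSum-separates h {ε = e ∷ ε} {e' ∷ ε'} ε≢ε' z with e Signₚ.≟ e'
... | yes refl = SignedSumGap-∷ e (signedSum-separates h (ε≢ε' ∘ cong (e ∷_)) z)
... | no e≢e' = SignedSumGap-opposite h ε ε' e≢e' z

ι-intersect : ∀ {m k} .{{_ : NonZero m}} (q q' : Fin m) (ε ε' : Vec Sign k) {j j'} →
  j < (m ∸ 1) / 2 → j' < (m ∸ 1) / 2 → (vs : Vec (Fin m) k) →
  signedSum ε vs - signedSum ε' vs ≈ (+ toℕ q + + (2 ℕ.* j)) - (+ toℕ q' + + (2 ℕ.* j')) [mod m ] →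
  Σ (Vec (Fin m) (suc k)) λ v → ι q ε v × ι q' ε' v
ι-intersect {m} q q' ε ε' {j} {j'} j<h j'<h vs gap =
  let t = + toℕ q + + (2 ℕ.* j)
      t' = + toℕ q' + + (2 ℕ.* j')
      r , r≈t-s = residue m (t - signedSum ε vs)
      meets-t , meets-t' = meeting-point t t' (signedSum ε vs) (signedSum ε' vs) r≈t-s gap
  in r ∷ vs , (j , j<h , unwrap meets-t) , (j' , j'<h , unwrap meets-t')

<⇒<half : ∀ {h j} → j < h → j < (suc (h ℕ.* 2) ∸ 1) / 2
<⇒<half {h} {j} j<h = subst (j <_) (sym (m*n/n≡m h 2)) j<h

evenDifference⇒ι-intersect : ∀ {h k} (q q' : Fin (suc (h ℕ.* 2))) (ε : Vec Sign k) {d} →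
  + toℕ q' ≈ + toℕ q + + d [mod suc (h ℕ.* 2) ] → EvenDifference h d →
  Σ (Vec (Fin (suc (h ℕ.* 2))) (suc k)) λ v → ι q ε v × ι q' ε v
evenDifference⇒ι-intersect {h} {k} q q' ε {d} q'≈q+d (j , j' , j<h , j'<h , 2j≈d+2j') =
  ι-intersect q q' ε ε (<⇒<half j<h) (<⇒<half j'<h) zeros
    (≈-trans (≡⇒≈ (ℤₚ.+-inverseʳ (signedSum ε zeros))) (≈-sym (≈⇒minus≈0 _ _ t≈t')))
  where
  open ≈-Reasoning (suc (h ℕ.* 2))
  zeros : Vec (Fin (suc (h ℕ.* 2))) k
  zeros = replicate k zero
  t≈t' : + toℕ q + + (2 ℕ.* j) ≈ + toℕ q' + + (2 ℕ.* j') [mod suc (h ℕ.* 2) ]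
  t≈t' = begin
    + toℕ q + + (2 ℕ.* j)            ≈⟨ +-congˡ-≈ (+ toℕ q) 2j≈d+2j' ⟩
    + toℕ q + (+ d + + (2 ℕ.* j'))   ≡⟨ ℤₚ.+-assoc (+ toℕ q) (+ d) (+ (2 ℕ.* j')) ⟨
    + toℕ q + + d + + (2 ℕ.* j')     ≈⟨ +-congʳ-≈ (+ (2 ℕ.* j')) q'≈q+d ⟨
    + toℕ q' + + (2 ℕ.* j')          ∎

Disjoint : ∀ {m k} → Fin m → Vec Sign k → Fin m → Vec Sign k → Set
Disjoint q ε q' ε' = ∀ v → ¬ (ι q ε v × ι q' ε' v)

disjoint⇒≡ : ∀ {h k} (q q' : Fin (suc (h ℕ.* 2))) {ε ε' : Vec Sign k} →
  0 < h → Disjoint q ε q' ε' → ε ≡ ε'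
disjoint⇒≡ {h} q q' {ε} {ε'} 0<h disjoint with Vecₚ.≡-dec Signₚ._≟_ ε ε'
... | yes ε≡ε' = ε≡ε'
... | no ε≢ε' =
  let vs , gap = signedSum-separates h ε≢ε' ((+ toℕ q + + 0) - (+ toℕ q' + + 0))
      v , meet = ι-intersect q q' ε ε' (<⇒<half 0<h) (<⇒<half 0<h) vs gap
  in ⊥-elim (disjoint v meet)

+[m∸1]≈-1 : ∀ h a → a + + (h ℕ.* 2) ≈ a - + 1 [mod suc (h ℕ.* 2) ]
+[m∸1]≈-1 h a = begin
  a + + (h ℕ.* 2)              ≡⟨ borrow a (+ (h ℕ.* 2)) ⟩
  (a - + 1) + + suc (h ℕ.* 2)  ≈⟨ +-congˡ-≈ (a - + 1) modulus≈0 ⟩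
  (a - + 1) + + 0              ≡⟨ ℤₚ.+-identityʳ (a - + 1) ⟩
  a - + 1                      ∎
  where
  open ≈-Reasoning (suc (h ℕ.* 2))
  borrow : ∀ a x → a + x ≡ (a - + 1) + (+ 1 + x)
  borrow = solve-∀

disjoint⇒adjacent : ∀ {h k} (q q' : Fin (suc (h ℕ.* 2))) {ε : Vec Sign k} →
  0 < h → Disjoint q ε q' ε →
  (+ toℕ q' ≡[mod suc (h ℕ.* 2) ] (+ toℕ q + + 1)) ⊎ (+ toℕ q' ≡[mod suc (h ℕ.* 2) ] (+ toℕ q - + 1))
disjoint⇒adjacent {h} q q' {ε} 0<h disjoint
  with residue (suc (h ℕ.* 2)) (+ toℕ q' - + toℕ q)
... | d , d≈q'-q with minus≈⇒≈+ (+ toℕ q) (+ toℕ q') (+ toℕ d) (≈-sym d≈q'-q)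
...   | q'≈q+d with ±1⊎evenDifference 0<h (toℕ<n d)
...     | inj₁ d≡1 = inj₁ (unwrap (≈-trans q'≈q+d (≡⇒≈ (cong (λ n → + toℕ q + + n) d≡1))))
...     | inj₂ (inj₁ d≡2h) = inj₂ (unwrap (≈-trans q'≈q+d
                               (≈-trans (≡⇒≈ (cong (λ n → + toℕ q + + n) d≡2h)) (+[m∸1]≈-1 h (+ toℕ q)))))
...     | inj₂ (inj₂ even-difference) =
  let v , meet = evenDifference⇒ι-intersect q q' ε q'≈q+d even-difference in ⊥-elim (disjoint v meet)

odd⇒≡suc[h*2] : ∀ {m} → 3 ≤ m → m % 2 ≡ 1 → Σ ℕ λ h → 0 < h × m ≡ suc (h ℕ.* 2)
odd⇒≡suc[h*2] {m} 3≤m m%2≡1 =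
  m / 2 , m≥n⇒m/n>0 (ℕₚ.<⇒≤ 3≤m) , trans (m≡m%n+[m/n]*n m 2) (cong (ℕ._+ m / 2 ℕ.* 2) m%2≡1)

lemma3p3 : (m k : ℕ) → 3 ≤ m → m % 2 ≡ 1 →
    (q q' : Fin m) (ε ε' : Vec Sign k) →
    (∀ (v : Vec (Fin m) (suc k)) → ¬ (ι q ε v × ι q' ε' v)) →
    ((+ toℕ q' ≡[mod m ] (+ toℕ q + + 1)) ⊎ (+ toℕ q' ≡[mod m ] (+ toℕ q - + 1)))
      × ε ≡ ε'
lemma3p3 m k 3≤m m%2≡1 q q' ε ε' disjoint with odd⇒≡suc[h*2] 3≤m m%2≡1
... | h , 0<h , refl with disjoint⇒≡ q q' 0<h disjoint
...   | refl = disjoint⇒adjacent q q' 0<h disjoint , refl
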